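{- Let $\mathbf{RbC}$ be the logic obtained from $\mathbf{RmbC}$ by adding the axiom schema (cf): $\neg\neg\alpha\to\alpha$. Then $\mathbf{RbC}$ is an extension of the logic $\mathbf{bC}$ (that is, $\Gamma\vdash_{\mathbf{bC}}\varphi$ implies $\Gamma\vdash_{\mathbf{RbC}}\varphi$) which satisfies the replacement property and is paraconsistent (that is, $\varphi,\neg\varphi\nvdash_{\mathbf{RbC}}\psi$ for some formulas $\varphi,\psi$). Moreover, $\mathbf{RbC}$ is a Logic of Formal Inconsistency with respect to $\neg$ and $\circ$.
   Context: Let $\Sigma=\{\wedge,\vee,\to,\neg,\circ\}$ ($\neg,\circ$ unary, the others binary) and let $For(\Sigma)$ be the set of formulas over $\Sigma$ generated by a denumerable set $\mathcal V$ of propositional variables. $\alpha\leftrightarrow\beta$ abbreviates $(\alpha\to\beta)\wedge(\beta\to\alpha)$. The logic $\mathbf{mbC}$ is given by the Hilbert calculus with axiom schemas: (Ax1) $\alpha\to(\beta\to\alpha)$; (Ax2) $(\alpha\to(\beta\to\gamma))\to((\alpha\to\beta)\to(\alpha\to\gamma))$; (Ax3) $\alpha\to(\beta\to(\alpha\wedge\beta))$; (Ax4) $(\alpha\wedge\beta)\to\alpha$; (Ax5) $(\alpha\wedge\beta)\to\beta$; (Ax6) $\alpha\to(\alpha\vee\beta)$; (Ax7) $\beta\to(\alpha\vee\beta)$; (Ax8) $(\alpha\to\gamma)\to((\beta\to\gamma)\to((\alpha\vee\beta)\to\gamma))$; (Ax9) $(\alpha\to\beta)\vee\alpha$; (Ax10)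 $\alpha\vee\neg\alpha$; (bc1) $\circ\alpha\to(\alpha\to(\neg\alpha\to\beta))$; and the single rule modus ponens (MP): from $\alpha$ and $\alpha\to\beta$ infer $\beta$. The logic $\mathbf{bC}$ is $\mathbf{mbC}$ plus the axiom schema (cf); derivations from premises in $\mathbf{mbC}$ and $\mathbf{bC}$ are the usual Hilbert-style ones. The calculus $\mathbf{RmbC}$ is obtained from $\mathbf{mbC}$ by adding the rules $(\mathbf R_\neg)$: from $\alpha\leftrightarrow\beta$ infer $\neg\alpha\leftrightarrow\neg\beta$; and $(\mathbf R_\circ)$: from $\alpha\leftrightarrow\beta$ infer $\circ\alpha\leftrightarrow\circ\beta$. In $\mathbf{RmbC}$ and its axiomatic extensions, $\varphi$ is a theorem ($\vdash\varphi$) if there is a finite sequence of formulas ending in $\varphi$ each of which is an instance of an axiom schema or follows from earlier formulas of the sequence by a rule; and $\Gamma\vdash\varphi$ means that either $\vdash\varphi$ or there is a finite non-empty $\{\gamma_1,\dots,\gamma_n\}\subseteq\Gamma$ with $\vdash(\gamma_1\wedge(\gamma_2\wedge(\cdots\wedge(\gamma_{n-1}\wedge\gamma_n)\cdots)))\to\varphi$. Replacement property: if $\alpha\leftrightarrow\beta$ is a theorem, then $\gamma[p/\alpha]\leftrightarrow\gamma[p/\beta]$ is a theorem for every formula $\gamma$ and variable $p$, where $\gamma[p/\alpha]$ is the result of replacing every occurrence of $p$ in $\gamma$ by $\alpha$. A Tarskian (reflexive, monotone, transitive), finitary and structural (substitution-invariant) logic with consequence $\vdash$ is a Logic of Formal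 Inconsistency w.r.t. $\neg$ and $\circ$ if: (i) $\varphi,\neg\varphi\nvdash\psi$ for some $\varphi,\psi$; (ii) $\circ\varphi,\varphi,\neg\varphi\vdash\psi$ for all $\varphi,\psi$; (iii) there are formulas $\alpha,\beta$ such that $\circ\alpha,\alpha\nvdash\beta$ and $\circ\alpha,\neg\alpha\nvdash\beta$. -}

module Defs where

open import Data.Bool using (if_then_else_)
open import Data.List using (List; []; _∷_)
open import Data.List.Membership.Propositional using (_∈_)
open import Data.List.NonEmpty using (List⁺; foldr₁)
import Data.List.NonEmpty.Relation.Unary.All as List⁺
open import Data.List.Relation.Unary.All using (All)
open import Data.Nat using (ℕ; _≡ᵇ_)
open import Data.Product using (_×_; ∃; ∃-syntax)
open import Data.Sum using (_⊎_)
open import Level using (0ℓ)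
open import Relation.Binary.PropositionalEquality using (_≡_)
open import Relation.Nullary using (¬_)
open import Relation.Unary using (Pred; ∅; _∪_; ｛_｝; _⊆_)

infix  9 ∼_ ○_
infixr 7 _∧_
infixr 6 _∨_
infixr 5 _⇒_
infix  4 _⇔_

-- ∼ is the (paraconsistent) negation of the object language, written ∼ to keep
-- it apart from the metatheoretic ¬; ○ is the consistency operator ∘.
data Formula : Set where
  var         : ℕ → Formula
  _∧_ _∨_ _⇒_ : Formula → Formula → Formula
  ∼_ ○_       : Formula → Formula

_⇔_ : Formula → Formula → Formula
α ⇔ β = (α ⇒ β) ∧ (β ⇒ α)

FormulaSet : Set₁
FormulaSet = Pred Formula 0ℓ

Substitution : Set
Substitution = ℕ → Formula

subst : Substitution → Formula → Formula
subst σ (var q) = σ q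
subst σ (α ∧ β) = subst σ α ∧ subst σ β
subst σ (α ∨ β) = subst σ α ∨ subst σ β
subst σ (α ⇒ β) = subst σ α ⇒ subst σ β
subst σ (∼ α)   = ∼ subst σ α
subst σ (○ α)   = ○ subst σ α

infix 10 _[_/_]

_[_/_] : Formula → ℕ → Formula → Formula
γ [ p / α ] = subst (λ q → if q ≡ᵇ p then α else var q) γ

substSet : Substitution → FormulaSet → FormulaSet
substSet σ Γ ψ = ∃[ γ ] Γ γ × ψ ≡ subst σ γ

------------------------------------------------------------------------
-- Hilbert calculi

-- Rule ps φ: from the list of premises ps infer φ.
record Calculus : Set₁ where
  field
    Axiom : FormulaSet
    Rule  : List Formula → Formula → Set

open Calculus public

infixl 5 _+axiom_

_+axiom_ : Calculus → FormulaSet → Calculus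
C +axiom A = record { Axiom = Axiom C ∪ A ; Rule = Rule C }

data Justified (C : Calculus) (Γ : FormulaSet) (earlier : List Formula)
               (φ : Formula) : Set where
  axiom   : Axiom C φ → Justified C Γ earlier φ
  premise : Γ φ → Justified C Γ earlier φ
  rule    : ∀ {ps} → Rule C ps φ → All (_∈ earlier) ps → Justified C Γ earlier φ

-- Derivations are sequences of formulas, listed with the last formula first.
data Derivation (C : Calculus) (Γ : FormulaSet) : List Formula → Set where
  []  : Derivation C Γ []
  _∷_ : ∀ {φ earlier} → Justified C Γ earlier φ → Derivation C Γ earlier →
        Derivation C Γ (φ ∷ earlier)

HilbertDerivable : Calculus → FormulaSet → Formula → Set
HilbertDerivable C Γ φ = ∃[ earlier ] Derivation C Γ (φ ∷ earlier)

Theorem : Calculus → FormulaSet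
Theorem C φ = HilbertDerivable C ∅ φ

-- γ₁ ∧ (γ₂ ∧ (⋯ ∧ γₙ))
⋀ : List⁺ Formula → Formula
⋀ = foldr₁ _∧_

-- The consequence relation used when the calculus has rules that may only be
-- applied to theorems: premises enter through an implication.
GlobalRuleDerivable : Calculus → FormulaSet → Formula → Set
GlobalRuleDerivable C Γ φ =
  Theorem C φ ⊎ ∃[ γs ] List⁺.All Γ γs × Theorem C (⋀ γs ⇒ φ)

------------------------------------------------------------------------
-- The logics mbC, bC, RmbC, RbC

data mbCAxiom : FormulaSet where
  Ax1  : ∀ α β → mbCAxiom (α ⇒ (β ⇒ α))
  Ax2  : ∀ α β γ → mbCAxiom ((α ⇒ (β ⇒ γ)) ⇒ ((α ⇒ β) ⇒ (α ⇒ γ)))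
  Ax3  : ∀ α β → mbCAxiom (α ⇒ (β ⇒ (α ∧ β)))
  Ax4  : ∀ α β → mbCAxiom ((α ∧ β) ⇒ α)
  Ax5  : ∀ α β → mbCAxiom ((α ∧ β) ⇒ β)
  Ax6  : ∀ α β → mbCAxiom (α ⇒ (α ∨ β))
  Ax7  : ∀ α β → mbCAxiom (β ⇒ (α ∨ β))
  Ax8  : ∀ α β γ → mbCAxiom ((α ⇒ γ) ⇒ ((β ⇒ γ) ⇒ ((α ∨ β) ⇒ γ)))
  Ax9  : ∀ α β → mbCAxiom ((α ⇒ β) ∨ α)
  Ax10 : ∀ α → mbCAxiom (α ∨ (∼ α))
  bc1  : ∀ α β → mbCAxiom ((○ α) ⇒ (α ⇒ ((∼ α) ⇒ β)))

data cfAxiom : FormulaSet where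
  cf : ∀ α → cfAxiom ((∼ (∼ α)) ⇒ α)

data mbCRule : List Formula → Formula → Set where
  MP : ∀ α β → mbCRule (α ∷ (α ⇒ β) ∷ []) β

data RmbCRule : List Formula → Formula → Set where
  MP : ∀ α β → RmbCRule (α ∷ (α ⇒ β) ∷ []) β
  R∼ : ∀ α β → RmbCRule ((α ⇔ β) ∷ []) ((∼ α) ⇔ (∼ β))
  R○ : ∀ α β → RmbCRule ((α ⇔ β) ∷ []) ((○ α) ⇔ (○ β))

mbC bC RmbC RbC : Calculus
mbC  = record { Axiom = mbCAxiom ; Rule = mbCRule }
bC   = mbC +axiom cfAxiom
RmbC = record { Axiom = mbCAxiom ; Rule = RmbCRule }
RbC  = RmbC +axiom cfAxiom

infix 3 _⊢bC_ _⊢RbC_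

_⊢bC_ _⊢RbC_ : FormulaSet → Formula → Set
_⊢bC_  = HilbertDerivable bC
_⊢RbC_ = GlobalRuleDerivable RbC

------------------------------------------------------------------------
-- Properties of logics

ReplacementProperty : Calculus → Set
ReplacementProperty C =
  ∀ α β → Theorem C (α ⇔ β) →
  ∀ γ p → Theorem C ((γ [ p / α ]) ⇔ (γ [ p / β ]))

Consequence : Set₁
Consequence = FormulaSet → Formula → Set

Paraconsistent : Consequence → Set
Paraconsistent _⊢_ = ∃[ φ ] ∃[ ψ ] ¬ ((｛ φ ｝ ∪ ｛ ∼ φ ｝) ⊢ ψ)

record IsLFI (_⊢_ : Consequence) : Set₁ where
  field
    reflexive  : ∀ {Γ φ} → Γ φ → Γ ⊢ φ
    monotone   : ∀ {Γ Δ φ} → Γ ⊆ Δ → Γ ⊢ φ → Δ ⊢ φ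
    transitive : ∀ {Γ Δ φ} → (∀ {γ} → Γ γ → Δ ⊢ γ) → Γ ⊢ φ → Δ ⊢ φ
    finitary   : ∀ {Γ φ} → Γ ⊢ φ → ∃[ γs ] All Γ γs × ((_∈ γs) ⊢ φ)
    structural : ∀ {Γ φ} σ → Γ ⊢ φ → substSet σ Γ ⊢ subst σ φ

    nonExplosive     : Paraconsistent _⊢_
    gentlyExplosive  : ∀ φ ψ → (｛ ○ φ ｝ ∪ ｛ φ ｝ ∪ ｛ ∼ φ ｝) ⊢ ψ
    nonTrivial       : ∃[ α ] ∃[ β ]
                         ¬ ((｛ ○ α ｝ ∪ ｛ α ｝) ⊢ β) ×
                         ¬ ((｛ ○ α ｝ ∪ ｛ ∼ α ｝) ⊢ β)

{-# OPTIONS --safe #-}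

-- Replacement follows by induction on the formula: the positive connectives are
-- monotone or antitone in positive logic, and ∼ and ○ are covered by R∼ and R○.
-- The Tarskian properties are read off the consequence relation generated by
-- theorems, premises and modus ponens, which equals ⊢RbC by the deduction theorem.
-- Non-derivability is shown in the four-element Boolean algebra 2 × 2 with ∼ 1 = 0,
-- ∼ x = 1 for x ≠ 1, and ○ x the complement of x ∧ ∼ x: an atom x then satisfies
-- x ∧ ∼ x = x ≠ 0.

module Submission where

open import Defs
open import Data.Bool as Bool using (Bool; true; false; not)
open import Data.List using ([]; _∷_; _++_)
open import Data.List.Membership.Propositional using (_∈_)
open import Data.List.Membership.Propositional.Properties using (∈-++⁺ˡ; ∈-++⁺ʳ)
open import Data.List.NonEmpty using (_∷_)
import Data.List.NonEmpty.Relation.Unary.All as List⁺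
open import Data.List.Relation.Unary.All as All using (All; []; _∷_)
import Data.List.Relation.Unary.All.Properties as All
open import Data.List.Relation.Unary.Any using (here; there)
open import Data.Nat using (ℕ; _≡ᵇ_)
open import Data.Product using (_×_; _,_; ∃-syntax)
open import Data.Sum using (inj₁; inj₂)
open import Function using (case_of_)
open import Relation.Binary.PropositionalEquality using (_≡_; refl; cong₂)
open import Relation.Nullary using (¬_)
open import Relation.Unary using (∅; _∪_; ｛_｝; _⊆_)

-- Hilbert derivations

module _ {C : Calculus} {Γ : FormulaSet} where

  Justified-weaken : ∀ {xs ys} → (∀ {ψ} → ψ ∈ xs → ψ ∈ ys) →
                     ∀ {φ} → Justified C Γ xs φ → Justified C Γ ys φ
  Justified-weaken xs⊆ys (axiom a)   = axiom a
  Justified-weaken xs⊆ys (premise p) = premise p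
  Justified-weaken xs⊆ys (rule r ps) = rule r (All.map xs⊆ys ps)

  Derivation-++ : ∀ {xs ys} → Derivation C Γ xs → Derivation C Γ ys →
                  Derivation C Γ (xs ++ ys)
  Derivation-++ []      e = e
  Derivation-++ (j ∷ d) e = Justified-weaken ∈-++⁺ˡ j ∷ Derivation-++ d e

  derive-axiom : ∀ {φ} → Axiom C φ → HilbertDerivable C Γ φ
  derive-axiom a = [] , axiom a ∷ []

  -- A rule cites all its premises from one sequence, so their separate derivations are merged into
  -- a single one.
  Derivation-containing : ∀ {ps} → All (HilbertDerivable C Γ) ps →
                          ∃[ xs ] Derivation C Γ xs × All (_∈ xs) ps
  Derivation-containing [] = [] , [] , []
  Derivation-containing ((xs , d) ∷ ds) =
    let ys , e , ps∈ys = Derivation-containing ds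
    in _ , Derivation-++ d e , here refl ∷ All.map (∈-++⁺ʳ (_ ∷ xs)) ps∈ys

  derive-rule : ∀ {ps φ} → Rule C ps φ → All (HilbertDerivable C Γ) ps →
                HilbertDerivable C Γ φ
  derive-rule r ds = let xs , d , ps∈xs = Derivation-containing ds
                     in xs , rule r ps∈xs ∷ d

  module _ {P : Formula → Set}
           (onAxiom   : ∀ {φ} → Axiom C φ → P φ)
           (onPremise : ∀ {φ} → Γ φ → P φ)
           (onRule    : ∀ {ps φ} → Rule C ps φ → All P ps → P φ) where

    -- A rule may cite any earlier formula, so the induction hypothesis has to cover every entry of
    -- the sequence and not just the last.
    Derivation-elim : ∀ {xs} → Derivation C Γ xs → All P xs
    Derivation-elim []      = []
    Derivation-elim (j ∷ d) = justified j ∷ ih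
      where
      ih = Derivation-elim d
      justified : ∀ {φ} → Justified C Γ _ φ → P φ
      justified (axiom a)   = onAxiom a
      justified (premise p) = onPremise p
      justified (rule r ps) = onRule r (All.map (All.lookup ih) ps)

    HilbertDerivable-elim : ∀ {φ} → HilbertDerivable C Γ φ → P φ
    HilbertDerivable-elim (_ , d) = All.head (Derivation-elim d)

-- Consequence generated by theorems, premises and modus ponens

infix 3 _⊩_

data _⊩_ (Γ : FormulaSet) : Formula → Set where
  theorem : ∀ {φ} → Theorem RbC φ → Γ ⊩ φ
  premise : ∀ {φ} → Γ φ → Γ ⊩ φ
  mp      : ∀ {φ ψ} → Γ ⊩ φ ⇒ ψ → Γ ⊩ φ → Γ ⊩ ψ

ax : ∀ {Γ φ} → mbCAxiom φ → Γ ⊩ φ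
ax a = theorem (derive-axiom (inj₁ a))

⊩-theorem : ∀ {φ} → ∅ ⊩ φ → Theorem RbC φ
⊩-theorem (theorem t) = t
⊩-theorem (mp d e)    = derive-rule (MP _ _) (⊩-theorem e ∷ ⊩-theorem d ∷ [])

⊩-trans : ∀ {Γ Δ φ} → (∀ {γ} → Γ γ → Δ ⊩ γ) → Γ ⊩ φ → Δ ⊩ φ
⊩-trans f (theorem t) = theorem t
⊩-trans f (premise p) = f p
⊩-trans f (mp d e)    = mp (⊩-trans f d) (⊩-trans f e)

⊩-mono : ∀ {Γ Δ φ} → Γ ⊆ Δ → Γ ⊩ φ → Δ ⊩ φ
⊩-mono Γ⊆Δ = ⊩-trans λ p → premise (Γ⊆Δ p)

⇒-const : ∀ {Γ α β} → Γ ⊩ β → Γ ⊩ α ⇒ β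
⇒-const = mp (ax (Ax1 _ _))

⇒-refl : ∀ {Γ} α → Γ ⊩ α ⇒ α
⇒-refl α = mp (mp (ax (Ax2 α (α ⇒ α) α)) (ax (Ax1 _ _))) (ax (Ax1 _ _))

-- `R∼` and `R○` occur only inside `theorem`, and a theorem can be prefixed with any antecedent by
-- `Ax1`. What remains is the classical argument for modus ponens.
deduction : ∀ {Γ α β} → Γ ∪ ｛ α ｝ ⊩ β → Γ ⊩ α ⇒ β
deduction (theorem t)           = ⇒-const (theorem t)
deduction (premise (inj₁ p))    = ⇒-const (premise p)
deduction (premise (inj₂ refl)) = ⇒-refl _
deduction (mp d e)              = mp (mp (ax (Ax2 _ _ _)) (deduction d)) (deduction e)

weaken : ∀ {Γ α φ} → Γ ⊩ φ → Γ ∪ ｛ α ｝ ⊩ φ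
weaken = ⊩-mono inj₁

assumption : ∀ {Γ α} → Γ ∪ ｛ α ｝ ⊩ α
assumption = premise (inj₂ refl)

∧-intro : ∀ {Γ α β} → Γ ⊩ α → Γ ⊩ β → Γ ⊩ α ∧ β
∧-intro d e = mp (mp (ax (Ax3 _ _)) d) e

∧-elimˡ : ∀ {Γ α β} → Γ ⊩ α ∧ β → Γ ⊩ α
∧-elimˡ = mp (ax (Ax4 _ _))

∧-elimʳ : ∀ {Γ α β} → Γ ⊩ α ∧ β → Γ ⊩ β
∧-elimʳ = mp (ax (Ax5 _ _))

⇒-trans : ∀ {Γ α β γ} → Γ ⊩ α ⇒ β → Γ ⊩ β ⇒ γ → Γ ⊩ α ⇒ γ
⇒-trans d e = mp (mp (ax (Ax2 _ _ _)) (⇒-const e)) d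

⊩-finitary : ∀ {Γ φ} → Γ ⊩ φ → ∃[ γs ] All Γ γs × ((_∈ γs) ⊩ φ)
⊩-finitary (theorem t) = [] , [] , theorem t
⊩-finitary (premise p) = _ , p ∷ [] , premise (here refl)
⊩-finitary (mp d e) =
  let γs , Γγs , d′ = ⊩-finitary d
      δs , Γδs , e′ = ⊩-finitary e
  in γs ++ δs , All.++⁺ Γγs Γδs ,
     mp (⊩-mono ∈-++⁺ˡ d′) (⊩-mono (∈-++⁺ʳ γs) e′)

-- Agreement of `⊩` with `⊢RbC`

⋀-elim : ∀ {Δ γ} γ₁ γs → Δ ⊩ ⋀ (γ₁ ∷ γs) → γ ∈ γ₁ ∷ γs → Δ ⊩ γ
⋀-elim γ₁ []        d (here refl) = d
⋀-elim γ₁ (_ ∷ _)   d (here refl) = ∧-elimˡ d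
⋀-elim γ₁ (γ₂ ∷ γs) d (there i)   = ⋀-elim γ₂ γs (∧-elimʳ d) i

⋀-intro : ∀ {Δ} γ₁ γs → All (Δ ⊩_) (γ₁ ∷ γs) → Δ ⊩ ⋀ (γ₁ ∷ γs)
⋀-intro γ₁ []        (d ∷ []) = d
⋀-intro γ₁ (γ₂ ∷ γs) (d ∷ ds) = ∧-intro d (⋀-intro γ₂ γs ds)

⊩⇒⊢ : ∀ {Γ φ} → Γ ⊩ φ → Γ ⊢RbC φ
⊩⇒⊢ d with ⊩-finitary d
-- A conjunction needs at least one conjunct, so a derivation that uses no premise has to give a
-- theorem.
... | [] , _ , e = inj₁ (⊩-theorem (⊩-mono (λ ()) e))
... | γ₁ ∷ γs , p ∷ ps , e =
  inj₂ (γ₁ ∷ γs , p List⁺.∷ ps ,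
        -- The conjunction is the one hypothesis discharged; each premise used is recovered from it.
        ⊩-theorem (deduction (⊩-trans (⋀-elim γ₁ γs assumption) e)))

⊢⇒⊩ : ∀ {Γ φ} → Γ ⊢RbC φ → Γ ⊩ φ
⊢⇒⊩ (inj₁ t) = theorem t
⊢⇒⊩ (inj₂ (γ₁ ∷ γs , p List⁺.∷ ps , t)) =
  mp (theorem t) (⋀-intro γ₁ γs (All.map premise (p ∷ ps)))

-- Both calculi have the same axioms, and the only rule of `bC` is modus ponens, which `⊩` allows
-- under premises.
bC⇒RbC : ∀ {Γ φ} → Γ ⊢bC φ → Γ ⊢RbC φ
bC⇒RbC d = ⊩⇒⊢ (HilbertDerivable-elim (λ a → theorem (derive-axiom a)) premise
  (λ { (MP _ _) (d ∷ e ∷ []) → mp e d }) d)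

-- Replacement

⇔-refl : ∀ {Γ} α → Γ ⊩ α ⇔ α
⇔-refl α = ∧-intro (⇒-refl α) (⇒-refl α)

∧-mono : ∀ {Γ α α′ β β′} → Γ ⊩ α ⇒ α′ → Γ ⊩ β ⇒ β′ → Γ ⊩ (α ∧ β) ⇒ (α′ ∧ β′)
∧-mono d e = deduction (∧-intro (mp (weaken d) (∧-elimˡ assumption))
                                (mp (weaken e) (∧-elimʳ assumption)))

∨-mono : ∀ {Γ α α′ β β′} → Γ ⊩ α ⇒ α′ → Γ ⊩ β ⇒ β′ → Γ ⊩ (α ∨ β) ⇒ (α′ ∨ β′)
∨-mono d e = mp (mp (ax (Ax8 _ _ _)) (⇒-trans d (ax (Ax6 _ _))))
                (⇒-trans e (ax (Ax7 _ _)))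

⇒-mono : ∀ {Γ α α′ β β′} → Γ ⊩ α′ ⇒ α → Γ ⊩ β ⇒ β′ → Γ ⊩ (α ⇒ β) ⇒ (α′ ⇒ β′)
⇒-mono d e = deduction (⇒-trans (weaken d) (⇒-trans assumption (weaken e)))

∧-cong : ∀ {Γ α α′ β β′} → Γ ⊩ α ⇔ α′ → Γ ⊩ β ⇔ β′ → Γ ⊩ (α ∧ β) ⇔ (α′ ∧ β′)
∧-cong d e = ∧-intro (∧-mono (∧-elimˡ d) (∧-elimˡ e)) (∧-mono (∧-elimʳ d) (∧-elimʳ e))

∨-cong : ∀ {Γ α α′ β β′} → Γ ⊩ α ⇔ α′ → Γ ⊩ β ⇔ β′ → Γ ⊩ (α ∨ β) ⇔ (α′ ∨ β′)
∨-cong d e = ∧-intro (∨-mono (∧-elimˡ d) (∧-elimˡ e)) (∨-mono (∧-elimʳ d) (∧-elimʳ e))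

⇒-cong : ∀ {Γ α α′ β β′} → Γ ⊩ α ⇔ α′ → Γ ⊩ β ⇔ β′ → Γ ⊩ (α ⇒ β) ⇔ (α′ ⇒ β′)
⇒-cong d e = ∧-intro (⇒-mono (∧-elimʳ d) (∧-elimˡ e)) (⇒-mono (∧-elimˡ d) (∧-elimʳ e))

-- The context is empty because `R∼` and `R○` apply to theorems only.
subst-cong : ∀ {σ τ : Substitution} → (∀ q → ∅ ⊩ σ q ⇔ τ q) →
             ∀ γ → ∅ ⊩ subst σ γ ⇔ subst τ γ
subst-cong h (var q) = h q
subst-cong h (α ∧ β) = ∧-cong (subst-cong h α) (subst-cong h β)
subst-cong h (α ∨ β) = ∨-cong (subst-cong h α) (subst-cong h β)
subst-cong h (α ⇒ β) = ⇒-cong (subst-cong h α) (subst-cong h β)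
subst-cong h (∼ α)   = theorem (derive-rule (R∼ _ _) (⊩-theorem (subst-cong h α) ∷ []))
subst-cong h (○ α)   = theorem (derive-rule (R○ _ _) (⊩-theorem (subst-cong h α) ∷ []))

replacement : ReplacementProperty RbC
replacement α β α⇔β γ p = ⊩-theorem (subst-cong pointwise γ)
  where
  pointwise : ∀ q → ∅ ⊩ (Bool.if q ≡ᵇ p then α else var q) ⇔
                        (Bool.if q ≡ᵇ p then β else var q)
  pointwise q with q ≡ᵇ p
  ... | true  = theorem α⇔β
  ... | false = ⇔-refl (var q)

-- Structurality

mbCAxiom-subst : ∀ σ {φ} → mbCAxiom φ → mbCAxiom (subst σ φ)
mbCAxiom-subst σ (Ax1 _ _)   = Ax1 _ _
mbCAxiom-subst σ (Ax2 _ _ _) = Ax2 _ _ _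
mbCAxiom-subst σ (Ax3 _ _)   = Ax3 _ _
mbCAxiom-subst σ (Ax4 _ _)   = Ax4 _ _
mbCAxiom-subst σ (Ax5 _ _)   = Ax5 _ _
mbCAxiom-subst σ (Ax6 _ _)   = Ax6 _ _
mbCAxiom-subst σ (Ax7 _ _)   = Ax7 _ _
mbCAxiom-subst σ (Ax8 _ _ _) = Ax8 _ _ _
mbCAxiom-subst σ (Ax9 _ _)   = Ax9 _ _
mbCAxiom-subst σ (Ax10 _)    = Ax10 _
mbCAxiom-subst σ (bc1 _ _)   = bc1 _ _

-- `subst` commutes with every connective, hence with `⇔`, so it maps instances of schemas and rules
-- to instances of the same ones.
Theorem-subst : ∀ σ {φ} → Theorem RbC φ → Theorem RbC (subst σ φ)
Theorem-subst σ = HilbertDerivable-elim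
  (λ { (inj₁ a)      → derive-axiom (inj₁ (mbCAxiom-subst σ a))
     ; (inj₂ (cf _)) → derive-axiom (inj₂ (cf _)) })
  (λ ())
  (λ { (MP _ _) (d ∷ e ∷ []) → derive-rule (MP _ _) (d ∷ e ∷ [])
     ; (R∼ _ _) (d ∷ [])     → derive-rule (R∼ _ _) (d ∷ [])
     ; (R○ _ _) (d ∷ [])     → derive-rule (R○ _ _) (d ∷ []) })

⊩-subst : ∀ σ {Γ φ} → Γ ⊩ φ → substSet σ Γ ⊩ subst σ φ
⊩-subst σ (theorem t) = theorem (Theorem-subst σ t)
⊩-subst σ (premise p) = premise (_ , p , refl)
⊩-subst σ (mp d e)    = mp (⊩-subst σ d) (⊩-subst σ e)

-- Semantics in the Boolean algebra 2 × 2

-- An element of 2 × 2 is a function Bool → Bool, the argument being the coordinate.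
Valuation : Set
Valuation = ℕ → Bool → Bool

⟦_⟧ : Formula → Valuation → Bool → Bool
⟦ var q ⟧ v i = v q i
⟦ α ∧ β ⟧ v i = ⟦ α ⟧ v i Bool.∧ ⟦ β ⟧ v i
⟦ α ∨ β ⟧ v i = ⟦ α ⟧ v i Bool.∨ ⟦ β ⟧ v i
⟦ α ⇒ β ⟧ v i = not (⟦ α ⟧ v i) Bool.∨ ⟦ β ⟧ v i
⟦ ∼ α ⟧   v i = not (⟦ α ⟧ v true Bool.∧ ⟦ α ⟧ v false)
⟦ ○ α ⟧   v i = not (⟦ α ⟧ v i Bool.∧ not (⟦ α ⟧ v true Bool.∧ ⟦ α ⟧ v false))

Valid : Valuation → Formula → Set
Valid v φ = ∀ i → ⟦ φ ⟧ v i ≡ true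

modusPonens-true : ∀ {a b} → not a Bool.∨ b ≡ true → a ≡ true → b ≡ true
modusPonens-true h refl = h

biconditional-true : ∀ a b → (not a Bool.∨ b) Bool.∧ (not b Bool.∨ a) ≡ true → a ≡ b
biconditional-true true  true  _ = refl
biconditional-true false false _ = refl

⇔-valid : ∀ {v} α β → Valid v (α ⇔ β) → ∀ i → ⟦ α ⟧ v i ≡ ⟦ β ⟧ v i
⇔-valid α β h i = biconditional-true _ _ (h i)

≡-valid : ∀ {v} α β → (∀ i → ⟦ α ⟧ v i ≡ ⟦ β ⟧ v i) → Valid v (α ⇔ β)
≡-valid {v} α β h i rewrite h i with ⟦ β ⟧ v i
... | true  = refl
... | false = refl

-- The positive axioms are classical tautologies, checked at each coordinate separately. For `Ax10`,
-- if `α` fails at one coordinate, the meet of its coordinates is false and `∼ α` is true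
-- everywhere.
mbCAxiom-valid : ∀ v {φ} → mbCAxiom φ → Valid v φ
mbCAxiom-valid v (Ax1 α β) i with ⟦ α ⟧ v i | ⟦ β ⟧ v i
... | false | _     = refl
... | true  | false = refl
... | true  | true  = refl
mbCAxiom-valid v (Ax2 α β γ) i with ⟦ α ⟧ v i | ⟦ β ⟧ v i | ⟦ γ ⟧ v i
... | false | _     | _     = refl
... | true  | false | _     = refl
... | true  | true  | false = refl
... | true  | true  | true  = refl
mbCAxiom-valid v (Ax3 α β) i with ⟦ α ⟧ v i | ⟦ β ⟧ v i
... | false | _     = refl
... | true  | false = refl
... | true  | true  = refl
mbCAxiom-valid v (Ax4 α β) i with ⟦ α ⟧ v i | ⟦ β ⟧ v i
... | false | _     = refl
... | true  | false = refl
... | true  | true  = refl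
mbCAxiom-valid v (Ax5 α β) i with ⟦ α ⟧ v i | ⟦ β ⟧ v i
... | false | _     = refl
... | true  | false = refl
... | true  | true  = refl
mbCAxiom-valid v (Ax6 α β) i with ⟦ α ⟧ v i
... | false = refl
... | true  = refl
mbCAxiom-valid v (Ax7 α β) i with ⟦ α ⟧ v i | ⟦ β ⟧ v i
... | _     | false = refl
... | false | true  = refl
... | true  | true  = refl
mbCAxiom-valid v (Ax8 α β γ) i with ⟦ α ⟧ v i | ⟦ β ⟧ v i | ⟦ γ ⟧ v i
... | false | false | false = refl
... | false | false | true  = refl
... | false | true  | false = refl
... | false | true  | true  = refl
... | true  | _     | false = refl
... | true  | false | true  = refl
... | true  | true  | true  = refl
mbCAxiom-valid v (Ax9 α β) i with ⟦ α ⟧ v i | ⟦ β ⟧ v i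
... | false | _     = refl
... | true  | false = refl
... | true  | true  = refl
mbCAxiom-valid v (Ax10 α) true with ⟦ α ⟧ v true
... | false = refl
... | true  = refl
mbCAxiom-valid v (Ax10 α) false with ⟦ α ⟧ v true | ⟦ α ⟧ v false
... | _     | true  = refl
... | false | false = refl
... | true  | false = refl
-- By the choice of `○`, the formulas `○ α`, `α` and `∼ α` are never all true at one coordinate,
-- whatever Boolean the meet is.
mbCAxiom-valid v (bc1 α β) i
  with ⟦ α ⟧ v i | ⟦ α ⟧ v true Bool.∧ ⟦ α ⟧ v false
... | false | _     = refl
... | true  | false = refl
... | true  | true  = refl

-- Since `∼ α` has the same value at both coordinates, `∼ ∼ α` is the meet of the coordinates of
-- `α`, which lies below `α` at each of them.
cf-valid : ∀ v α → Valid v ((∼ (∼ α)) ⇒ α)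
cf-valid v α true with ⟦ α ⟧ v true | ⟦ α ⟧ v false
... | false | _     = refl
... | true  | false = refl
... | true  | true  = refl
cf-valid v α false with ⟦ α ⟧ v true | ⟦ α ⟧ v false
... | false | _     = refl
... | true  | false = refl
... | true  | true  = refl

-- `R∼` and `R○` are sound because validity at both coordinates makes `α` and `β` the same element
-- of the algebra; agreement at one coordinate would not determine `∼`.
Theorem-valid : ∀ v {φ} → Theorem RbC φ → Valid v φ
Theorem-valid v = HilbertDerivable-elim
  (λ { (inj₁ a)      → mbCAxiom-valid v a
     ; (inj₂ (cf α)) → cf-valid v α })
  (λ ())
  (λ { (MP _ _) (p ∷ q ∷ []) i → modusPonens-true (q i) (p i)
     ; (R∼ α β) (p ∷ []) → ≡-valid (∼ α) (∼ β) λ _ → ∼-cong α β (⇔-valid α β p)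
     ; (R○ α β) (p ∷ []) → ≡-valid (○ α) (○ β) λ i →
         cong₂ (λ a n → not (a Bool.∧ n)) (⇔-valid α β p i)
               (∼-cong α β (⇔-valid α β p)) })
  where
  ∼-cong : ∀ α β → (∀ i → ⟦ α ⟧ v i ≡ ⟦ β ⟧ v i) →
           not (⟦ α ⟧ v true Bool.∧ ⟦ α ⟧ v false) ≡
           not (⟦ β ⟧ v true Bool.∧ ⟦ β ⟧ v false)
  ∼-cong α β h = cong₂ (λ a b → not (a Bool.∧ b)) (h true) (h false)

-- Premises are assumed true at the single coordinate `i`, which modus ponens preserves. Asking them
-- to be valid would be too strong for paraconsistency: `α` and `∼ α` are never both equal to 1.
⊢RbC-sound : ∀ v i {Γ φ} → Γ ⊢RbC φ → (∀ {γ} → Γ γ → ⟦ γ ⟧ v i ≡ true) →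
             ⟦ φ ⟧ v i ≡ true
⊢RbC-sound v i {Γ} d h = go (⊢⇒⊩ d)
  where
  go : ∀ {φ} → Γ ⊩ φ → ⟦ φ ⟧ v i ≡ true
  go (theorem t) = Theorem-valid v t i
  go (premise p) = h p
  go (mp d e)    = modusPonens-true (go d) (go e)

-- Countermodels

assign : (Bool → Bool) → Valuation
assign x 0         = x
-- The value 0 lets `var 1` serve as the refuted conclusion.
assign x (ℕ.suc _) = λ _ → false

paraconsistent : Paraconsistent _⊢RbC_
paraconsistent = var 0 , var 1 , λ d →
  -- The identity is the atom true exactly at coordinate `true`; its `∼` is 1, so both premises hold
  -- there.
  case ⊢RbC-sound (assign λ i → i) true d
         (λ { (inj₁ refl) → refl ; (inj₂ refl) → refl })
  of λ ()

consistency-nonTrivial : ∃[ α ] ∃[ β ] ¬ ((｛ ○ α ｝ ∪ ｛ α ｝) ⊢RbC β) ×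
                                       ¬ ((｛ ○ α ｝ ∪ ｛ ∼ α ｝) ⊢RbC β)
consistency-nonTrivial = var 0 , var 1 ,
  -- At the classical values 1 and, below, 0 the meet of `var 0` and `∼ var 0` is 0, so `○ var 0` is
  -- 1.
  (λ d → case ⊢RbC-sound (assign λ _ → true) true d
                (λ { (inj₁ refl) → refl ; (inj₂ refl) → refl })
         of λ ()) ,
  (λ d → case ⊢RbC-sound (assign λ _ → false) true d
                (λ { (inj₁ refl) → refl ; (inj₂ refl) → refl })
         of λ ())

RbC-isLFI : IsLFI _⊢RbC_
RbC-isLFI = record
  { reflexive       = λ p → ⊩⇒⊢ (premise p)
  ; monotone        = λ Γ⊆Δ d → ⊩⇒⊢ (⊩-mono Γ⊆Δ (⊢⇒⊩ d))
  ; transitive      = λ f d → ⊩⇒⊢ (⊩-trans (λ p → ⊢⇒⊩ (f p)) (⊢⇒⊩ d))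
  ; finitary        = λ d → let γs , Γγs , e = ⊩-finitary (⊢⇒⊩ d)
                            in γs , Γγs , ⊩⇒⊢ e
  ; structural      = λ σ d → ⊩⇒⊢ (⊩-subst σ (⊢⇒⊩ d))
  ; nonExplosive    = paraconsistent
  ; gentlyExplosive = λ φ ψ → ⊩⇒⊢
      (mp (mp (mp (ax (bc1 φ ψ)) (premise (inj₁ refl)))
              (premise (inj₂ (inj₁ refl))))
          (premise (inj₂ (inj₂ refl))))
  ; nonTrivial      = consistency-nonTrivial
  }

mainTheorem1 : (∀ (Γ : FormulaSet) (φ : Formula) → Γ ⊢bC φ → Γ ⊢RbC φ)
    × ReplacementProperty RbC
    × Paraconsistent _⊢RbC_
    × IsLFI _⊢RbC_
mainTheorem1 = (λ _ _ → bC⇒RbC) , replacement , paraconsistent , RbC-isLFI
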